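{- Let $n \geq 1$ be a positive integer. There exists a $\chi_g$-lower-game-vertex-critical graph $G$ such that $\chi_g(G)-\chi_g(G-x)=n$ for every vertex $x \in V(G)$.
   Context: All graphs are simple, undirected and finite. The coloring game on a graph $G$ with color set $\{1,\ldots,k\}$ is played by Alice and Bob. Alice moves first and the players alternate turns; in each turn the player colors a previously uncolored vertex with a color from $\{1,\ldots,k\}$ different from the colors already given to its neighbors. If at some point there is an uncolored vertex having all colors $1,\ldots,k$ in its neighborhood, Bob wins; otherwise, if all vertices get colored, Alice wins. The game chromatic number $\chi_g(G)$ is the minimum $k$ for which Alice has a winning strategy on $G$. For $x\in V(G)$, $G-x$ is the graph obtained from $G$ by deleting $x$ and all edges incident with $x$. A graph $G$ is $\chi_g$-lower-game-vertex-critical if $\chi_g(G-x)<\chi_g(G)$ for every $x\in V(G)$. -}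

module Defs where

open import Data.Fin.Base using (Fin; zero; suc; punchIn)
open import Data.Fin.Properties as Fin using (any?; all?; pigeonhole)
open import Data.Maybe.Base using (Maybe; just; nothing)
open import Data.Maybe.Properties using (≡-dec; just-injective)
open import Data.Nat.Base using (ℕ; zero; suc; _≤_; _<_; z≤n; s≤s; s≤s⁻¹)
open import Data.Nat.Properties using (≤-antisym; ≤-reflexive; ≤-refl; ≤-trans; n<1+n)
open import Data.Product.Base using (∃-syntax; _×_; _,_; proj₁; proj₂)
open import Data.Vec.Base using (Vec; []; _∷_; lookup; replicate; _[_]≔_)
open import Function.Base using (_∘_; _on_)
open import Level using (0ℓ)
open import Relation.Binary.Core using (Rel)
open import Relation.Binary.Definitions
  using (Symmetric; Irreflexive; DecidableEquality)
  renaming (Decidable to Decidable₂)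
open import Relation.Binary.PropositionalEquality
open import Relation.Nullary using (¬_; Dec; yes; no; contradiction)
open import Relation.Nullary.Decidable using (map′; ¬?; _×-dec_; decidable-stable)
open import Relation.Unary using (Pred; Decidable)

record Graph (n : ℕ) : Set₁ where
  field
    Adj         : Rel (Fin n) 0ℓ
    adj?        : Decidable₂ Adj
    symmetric   : Symmetric Adj
    irreflexive : Irreflexive _≡_ Adj

infixl 6 _-_

_-_ : ∀ {n} → Graph (suc n) → Fin (suc n) → Graph n
G - x = record
  { Adj         = Adj on punchIn x
  ; adj?        = λ u v → adj? (punchIn x u) (punchIn x v)
  ; symmetric   = symmetric
  ; irreflexive = irreflexive ∘ cong (punchIn x)
  } where open Graph G

Colouring : ℕ → ℕ → Set
Colouring k n = Vec (Maybe (Fin k)) n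

data Player : Set where
  alice bob : Player

module Game {n : ℕ} (G : Graph n) (k : ℕ) where
  open Graph G

  Uncoloured : Colouring k n → Pred (Fin n) 0ℓ
  Uncoloured c v = lookup c v ≡ nothing

  Appears : Colouring k n → Fin n → Fin k → Set
  Appears c v a = ∃[ u ] (Adj v u × lookup c u ≡ just a)

  Legal : Colouring k n → Fin n → Fin k → Set
  Legal c v a = Uncoloured c v × ¬ Appears c v a

  BobHasWon : Colouring k n → Set
  BobHasWon c = ∃[ v ] (Uncoloured c v × ∀ a → Appears c v a)

  -- An element of AliceWins p c is a winning strategy (a strategy tree) for
  -- Alice from the partial colouring c with player p to move.
  data AliceWins : Player → Colouring k n → Set where
    complete : ∀ {p c} → (∀ v → ¬ Uncoloured c v) → AliceWins p c
    alice-to-move : ∀ {c} → ¬ BobHasWon c → ∀ v a → Legal c v a →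
                    AliceWins bob (c [ v ]≔ just a) → AliceWins alice c
    bob-to-move : ∀ {c} → ¬ BobHasWon c →
                  (∀ v a → Legal c v a → AliceWins alice (c [ v ]≔ just a)) →
                  AliceWins bob c

AliceHasWinningStrategy : ∀ {n} → Graph n → ℕ → Set
AliceHasWinningStrategy {n} G k = Game.AliceWins G k alice (replicate n nothing)

IsGameChromaticNumber : ∀ {n} → Graph n → ℕ → Set
IsGameChromaticNumber G k =
  AliceHasWinningStrategy G k × (∀ j → AliceHasWinningStrategy G j → k ≤ j)

-- To define the game chromatic number as a function we show that the game is
-- decidable and that Alice wins on n vertices with n colours.

private
  _≟ᴹ_ : ∀ {k} → DecidableEquality (Maybe (Fin k))
  _≟ᴹ_ = ≡-dec Fin._≟_

  uncoloured : ∀ {k n} → Colouring k n → ℕ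
  uncoloured []            = 0
  uncoloured (nothing ∷ c) = suc (uncoloured c)
  uncoloured (just _ ∷ c)  = uncoloured c

  uncoloured-move : ∀ {k n} (c : Colouring k n) v {a} → lookup c v ≡ nothing →
                    suc (uncoloured (c [ v ]≔ just a)) ≡ uncoloured c
  uncoloured-move (nothing ∷ c) zero    _ = refl
  uncoloured-move (nothing ∷ c) (suc v) p = cong suc (uncoloured-move c v p)
  uncoloured-move (just _ ∷ c)  (suc v) p = uncoloured-move c v p

  uncoloured-zero : ∀ {k n} (c : Colouring k n) → uncoloured c ≤ 0 →
                    ∀ v → lookup c v ≢ nothing
  uncoloured-zero (just _ ∷ c) le (suc v) = uncoloured-zero c le v

  uncoloured-step : ∀ {k n f} (c : Colouring k n) v {a} → lookup c v ≡ nothing →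
                    uncoloured c ≤ suc f → uncoloured (c [ v ]≔ just a) ≤ f
  uncoloured-step c v p le = s≤s⁻¹ (≤-trans (≤-reflexive (uncoloured-move c v p)) le)

  module _ {n : ℕ} (G : Graph n) (k : ℕ) where
    open Graph G
    open Game G k

    uncoloured? : ∀ c → Decidable (Uncoloured c)
    uncoloured? c v = lookup c v ≟ᴹ nothing

    appears? : ∀ c v → Decidable (Appears c v)
    appears? c v a = any? λ u → adj? v u ×-dec (lookup c u ≟ᴹ just a)

    bobHasWon? : Decidable BobHasWon
    bobHasWon? c = any? λ v → uncoloured? c v ×-dec all? (appears? c v)

    legal? : ∀ c v → Decidable (Legal c v)
    legal? c v a = uncoloured? c v ×-dec ¬? (appears? c v a)

    complete? : ∀ c → Dec (∀ v → ¬ Uncoloured c v)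
    complete? c = all? (¬? ∘ uncoloured? c)

    any-legal? : ∀ {P : Fin n → Fin k → Set} c →
                 (∀ v a → Legal c v a → Dec (P v a)) →
                 Dec (∃[ v ] ∃[ a ] (Legal c v a × P v a))
    any-legal? c P? = any? λ v → any? λ a → dec v a
      where
      dec : ∀ v a → Dec _
      dec v a with legal? c v a
      ... | no ¬l = no (¬l ∘ proj₁)
      ... | yes l = map′ (l ,_) proj₂ (P? v a l)

    all-legal? : ∀ {P : Fin n → Fin k → Set} c →
                 (∀ v a → Legal c v a → Dec (P v a)) →
                 Dec (∀ v a → Legal c v a → P v a)
    all-legal? c P? = all? λ v → all? λ a → dec v a
      where
      dec : ∀ v a → Dec _
      dec v a with legal? c v a
      ... | no ¬l = yes λ l → contradiction l ¬l
      ... | yes l = map′ (λ p _ → p) (λ f → f l) (P? v a l)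

    aliceWins? : ∀ f p c → uncoloured c ≤ f → Dec (AliceWins p c)
    aliceWins? zero    p c le = yes (complete (uncoloured-zero c le))
    aliceWins? (suc f) p c le with complete? c | bobHasWon? c
    ... | yes full | _     = yes (complete full)
    ... | no ¬full | yes b = no λ
      { (complete full)            → ¬full full
      ; (alice-to-move ¬b _ _ _ _) → ¬b b
      ; (bob-to-move ¬b _)         → ¬b b
      }
    aliceWins? (suc f) alice c le | no ¬full | no ¬b =
      map′ (λ (v , a , l , w) → alice-to-move ¬b v a l w)
           (λ { (complete full)           → contradiction full ¬full
              ; (alice-to-move _ v a l w) → v , a , l , w })
           (any-legal? c λ v a l → aliceWins? f bob _ (uncoloured-step c v (proj₁ l) le))
    aliceWins? (suc f) bob c le | no ¬full | no ¬b =
      map′ (bob-to-move ¬b)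
           (λ { (complete full)   → contradiction full ¬full
              ; (bob-to-move _ w) → w })
           (all-legal? c λ v a l → aliceWins? f alice _ (uncoloured-step c v (proj₁ l) le))

  module _ {n : ℕ} (G : Graph n) where
    open Graph G
    open Game G n

    n-colours-¬bob : ∀ c → ¬ BobHasWon c
    n-colours-¬bob c (v , vᵤ , app)
      with pigeonhole (n<1+n n) g
      where
      g : Fin (suc n) → Fin n
      g zero    = v
      g (suc a) = proj₁ (app a)
    ... | zero , suc b , _ , eq = contradiction
      (trans (sym (trans (cong (lookup c) eq) (proj₂ (proj₂ (app b))))) vᵤ) λ ()
    ... | suc a , suc b , s≤s a<b , eq = Fin.<⇒≢ a<b (just-injective
      (trans (sym (proj₂ (proj₂ (app a))))
             (trans (cong (lookup c) eq) (proj₂ (proj₂ (app b))))))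

    n-colours-suffice : ∀ f p c → uncoloured c ≤ f → AliceWins p c
    n-colours-suffice zero    p     c le = complete (uncoloured-zero c le)
    n-colours-suffice (suc f) bob   c le = bob-to-move (n-colours-¬bob c) λ v a l →
      n-colours-suffice f alice _ (uncoloured-step c v (proj₁ l) le)
    n-colours-suffice (suc f) alice c le with any? (uncoloured? G n c)
    ... | no ¬u = complete λ v u → ¬u (v , u)
    ... | yes (v , u) with any? (¬? ∘ appears? G n c v)
    ...   | yes (a , ¬p) = alice-to-move (n-colours-¬bob c) v a (u , ¬p)
              (n-colours-suffice f bob _ (uncoloured-step c v u le))
    ...   | no ¬free = contradiction
              (v , u , λ a → decidable-stable (appears? G n c v a) λ ¬p → ¬free (a , ¬p))
              (n-colours-¬bob c)

  least : ∀ {P : Pred ℕ 0ℓ} → Decidable P → ∀ n → P n →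
          ∃[ k ] (P k × ∀ j → P j → k ≤ j)
  least P? zero    p = zero , p , λ _ _ → z≤n
  least P? (suc n) p with P? zero
  ... | yes p₀ = zero , p₀ , λ _ _ → z≤n
  ... | no ¬p₀ with k , pk , min ← least (P? ∘ suc) n p =
    suc k , pk , λ { zero p₀ → contradiction p₀ ¬p₀ ; (suc j) pj → s≤s (min j pj) }

aliceHasWinningStrategy? : ∀ {n} (G : Graph n) → Decidable (AliceHasWinningStrategy G)
aliceHasWinningStrategy? G k = aliceWins? G k _ alice _ ≤-refl

gameChromaticNumber : ∀ {n} (G : Graph n) → ∃[ k ] IsGameChromaticNumber G k
gameChromaticNumber {n} G =
  least (aliceHasWinningStrategy? G) n (n-colours-suffice G _ alice _ ≤-refl)

χg : ∀ {n} → Graph n → ℕ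
χg G = proj₁ (gameChromaticNumber G)

χg-isGameChromaticNumber : ∀ {n} (G : Graph n) → IsGameChromaticNumber G (χg G)
χg-isGameChromaticNumber G = proj₂ (gameChromaticNumber G)

χg-unique : ∀ {n} (G : Graph n) {k} → IsGameChromaticNumber G k → χg G ≡ k
χg-unique G (w , min) with w′ , min′ ← χg-isGameChromaticNumber G =
  ≤-antisym (min′ _ w) (min _ w′)

-- Indexed by suc n: the null graph would be critical vacuously.
LowerGameVertexCritical : ∀ {n} → Graph (suc n) → Set
LowerGameVertexCritical G = ∀ x → χg (G - x) < χg G

{-# OPTIONS --safe #-}

-- The graph is the crown on 2N vertices, K_{N,N} minus a perfect matching, with
-- N = n + 3. With k < N colours Bob answers each move of Alice by giving the
-- same colour to the twin (the matched vertex), so that every pair of twins uses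
-- up a colour of its own; N colours suffice because all degrees are N − 1.
-- After the deletion of x, Alice starts with the twin of x, whose colour α is
-- then barred from the whole side of x. After Bob's first reply v she colours
-- the twin of v so that a colour β is barred from the other side. From then on
-- each side has a colour that never appears in its neighbourhood, so three
-- colours suffice. Two do not, as Bob can put both of them on one side.

module Submission where

open import Defs
open import Data.Fin.Base using (Fin; zero; suc; punchIn; punchOut; opposite)
open import Data.Fin.Properties as Fin
  using (any?; all?; pigeonhole; ¬∀⟶∃¬; punchInᵢ≢i; punchIn-punchOut;
         punchIn-injective)
open import Data.Maybe.Base using (Maybe; just; nothing)
open import Data.Maybe.Properties using (≡-dec; just-injective)
open import Data.Nat.Base using (ℕ; zero; suc; _+_; _*_; _∸_; _≤_; _<_; _≥_; z≤n; s≤s)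
open import Data.Nat.Properties
  using (suc-injective; ≮⇒≥; ≤-refl; n<1+n; +-monoʳ-≤)
open import Data.Product.Base using (Σ; Σ-syntax; ∃-syntax; _×_; _,_; proj₁; proj₂)
open import Data.Sum.Base using (_⊎_; inj₁; inj₂)
open import Data.Unit.Base using (⊤; tt)
open import Data.Vec.Base using (Vec; []; _∷_; lookup; replicate; _[_]≔_)
open import Data.Vec.Properties using (lookup∘update; lookup∘update′; lookup-replicate)
open import Function.Base using (_∘_; case_of_)
open import Function.Bundles using (Inverse; _↔_)
open import Relation.Binary.PropositionalEquality
open import Relation.Nullary using (¬_; Dec; yes; no; contradiction)
open import Relation.Nullary.Decidable using (¬?; _×-dec_)

fresh : ∀ {m n} → m < n → (f : Fin m → Maybe (Fin n)) → ∃[ y ] ∀ i → f i ≢ just y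
fresh {n = n} m<n f = case all? hit? of λ
  -- With a preimage chosen for every colour, two colours would share one.
  { (yes onto) → let y , z , y<z , eq = pigeonhole m<n (proj₁ ∘ onto) in contradiction
      (just-injective (trans (sym (proj₂ (onto y))) (trans (cong f eq) (proj₂ (onto z)))))
      (Fin.<⇒≢ y<z)
  ; (no ¬onto) → let y , ¬hit = ¬∀⟶∃¬ _ _ hit? ¬onto in y , λ i eq → ¬hit (i , eq) }
  where
  hit? : (y : Fin n) → Dec (∃[ i ] f i ≡ just y)
  hit? y = any? λ i → ≡-dec Fin._≟_ (f i) (just y)

avoid : ∀ {m n} → m < n → (ys : Vec (Fin n) m) → ∃[ y ] ∀ i → lookup ys i ≢ y
avoid m<n ys with y , new ← fresh m<n (just ∘ lookup ys) = y , λ i → new i ∘ cong just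

opposite-≢ : ∀ (s : Fin 2) → opposite s ≢ s
opposite-≢ zero       ()
opposite-≢ (suc zero) ()

-- Stated for `n < 3` rather than for `Fin 2`, as it serves both for the two sides and for the
-- colours when `k < 3`.
≢⇒≡opposite : ∀ {n} → n < 3 → {i j : Fin n} → i ≢ j → i ≡ opposite j
≢⇒≡opposite     _ {zero}     {zero}     i≢j = contradiction refl i≢j
≢⇒≡opposite {2} _ {zero}     {suc zero} _   = refl
≢⇒≡opposite {2} _ {suc zero} {zero}     _   = refl
≢⇒≡opposite {2} _ {suc zero} {suc zero} i≢j = contradiction refl i≢j
≢⇒≡opposite {suc (suc (suc _))} (s≤s (s≤s (s≤s ())))

-- Partial colourings

module _ {k n : ℕ} (c : Colouring k n) (v : Fin n) {a : Fin k} where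

  coloured⁻ : ∀ {u b} → lookup (c [ v ]≔ just a) u ≡ just b →
              (u ≡ v × a ≡ b) ⊎ lookup c u ≡ just b
  coloured⁻ {u} eq with u Fin.≟ v
  ... | yes refl = inj₁ (refl , just-injective (trans (sym (lookup∘update v c _)) eq))
  ... | no u≢v   = inj₂ (trans (sym (lookup∘update′ u≢v c _)) eq)

  uncoloured⁻ : ∀ {u} → lookup (c [ v ]≔ just a) u ≡ nothing → lookup c u ≡ nothing
  uncoloured⁻ {u} eq with u Fin.≟ v
  ... | yes refl = case trans (sym (lookup∘update v c _)) eq of λ ()
  ... | no u≢v   = trans (sym (lookup∘update′ u≢v c _)) eq

  coloured⁺ : ∀ {u b} → lookup c v ≡ nothing → lookup c u ≡ just b →
              lookup (c [ v ]≔ just a) u ≡ just b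
  coloured⁺ {u} vᵤ eq with u Fin.≟ v
  ... | yes refl = case trans (sym vᵤ) eq of λ ()
  ... | no u≢v   = trans (lookup∘update′ u≢v c _) eq

blanks : ∀ {k n} → Colouring k n → ℕ
blanks []            = 0
blanks (nothing ∷ c) = suc (blanks c)
blanks (just _ ∷ c)  = blanks c

blanks-update : ∀ {k n} (c : Colouring k n) v {a} → lookup c v ≡ nothing →
                suc (blanks (c [ v ]≔ just a)) ≡ blanks c
blanks-update (nothing ∷ c) zero    _  = refl
blanks-update (nothing ∷ c) (suc v) vᵤ = cong suc (blanks-update c v vᵤ)
blanks-update (just _ ∷ c)  (suc v) vᵤ = blanks-update c v vᵤ

-- Invariants and barred colours on an arbitrary graph

module Strategies {n : ℕ} (G : Graph n) (k : ℕ) where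
  open Graph G
  open Game G k

  bobHasWon⇒¬aliceWins : ∀ p c → BobHasWon c → ¬ AliceWins p c
  bobHasWon⇒¬aliceWins _ _ (v , vᵤ , _) (complete full)            = full v vᵤ
  bobHasWon⇒¬aliceWins _ _ won          (alice-to-move ¬b _ _ _ _) = ¬b won
  bobHasWon⇒¬aliceWins _ _ won          (bob-to-move ¬b _)         = ¬b won

  unused⇒¬bobHasWon : ∀ c b → (∀ u → lookup c u ≢ just b) → ¬ BobHasWon c
  unused⇒¬bobHasWon c b unused (_ , _ , all) with u , _ , eq ← all b = unused u eq

  -- Since all legal moves preserve `I`, Alice needs no plan: any uncoloured vertex with its free
  -- colour will do. The recursion in `go` is on the number of blanks, which each move lowers by
  -- one.
  aliceWins-invariant :
    (I : Colouring k n → Set) →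
    (∀ c v → I c → Uncoloured c v → ∃[ a ] ¬ Appears c v a) →
    (∀ c v a → I c → Legal c v a → I (c [ v ]≔ just a)) →
    ∀ p c → I c → AliceWins p c
  aliceWins-invariant I free preserved p c = go _ p c refl
    where
    ¬bobHasWon : ∀ c → I c → ¬ BobHasWon c
    ¬bobHasWon c inv (v , vᵤ , all) with a , ¬app ← free c v inv vᵤ = ¬app (all a)

    go : ∀ f p c → blanks c ≡ f → I c → AliceWins p c
    go f p c eq inv with any? (λ v → ≡-dec Fin._≟_ (lookup c v) nothing)
    ... | no full = complete λ v vᵤ → full (v , vᵤ)
    go zero p c eq inv | yes (v , vᵤ) with a , _ ← free c v inv vᵤ =
      case trans (blanks-update c v {a} vᵤ) eq of λ ()
    go (suc f) alice c eq inv | yes (v , vᵤ) with a , ¬app ← free c v inv vᵤ =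
      alice-to-move (¬bobHasWon c inv) v a (vᵤ , ¬app)
        (go f bob _ (suc-injective (trans (blanks-update c v vᵤ) eq))
          (preserved c v a inv (vᵤ , ¬app)))
    go (suc f) bob c eq inv | yes _ =
      bob-to-move (¬bobHasWon c inv) λ v a l →
        go f alice _ (suc-injective (trans (blanks-update c v (proj₁ l)) eq))
          (preserved c v a inv l)

  -- The vertex v neither has nor can ever get the colour b.
  Barred : Colouring k n → Fin n → Fin k → Set
  Barred c v b = lookup c v ≢ just b × (Uncoloured c v → Appears c v b)

  -- Giving `v` the colour `b` is illegal because a neighbour has it, and that neighbour keeps its
  -- colour forever.
  barred-move : ∀ c u a v b → Legal c u a → Barred c v b → Barred (c [ u ]≔ just a) v b
  barred-move c u a v b (uᵤ , ¬app) (¬b , app) =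
    (λ eq → case coloured⁻ c u eq of λ
      { (inj₁ (refl , refl)) → ¬app (app uᵤ)
      ; (inj₂ old)           → ¬b old }) ,
    λ vᵤ → let w , adj , eq = app (uncoloured⁻ c u vᵤ) in w , adj , coloured⁺ c u uᵤ eq

  module _ (side : Fin n → Fin 2) (bipartite : ∀ u v → Adj u v → side u ≢ side v) where

    -- The neighbours of a vertex lie on the other side, so the colour barred there is always free
    -- for it; by `barred-move` the bars survive every move.
    barred-sides⇒aliceWins :
      ∀ t α β p c → (∀ v → side v ≡ t → Barred c v α) → (∀ v → side v ≢ t → Barred c v β) →
      AliceWins p c
    barred-sides⇒aliceWins t α β p c barα barβ = aliceWins-invariant
      I free
      (λ c u a (barα , barβ) l →
        (λ v s → barred-move c u a v α l (barα v s)) ,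
        (λ v s → barred-move c u a v β l (barβ v s)))
      p c (barα , barβ)
      where
      I : Colouring k n → Set
      I c = (∀ v → side v ≡ t → Barred c v α) × (∀ v → side v ≢ t → Barred c v β)

      free : ∀ c v → I c → Uncoloured c v → ∃[ a ] ¬ Appears c v a
      free c v (barα , barβ) _ with side v Fin.≟ t
      ... | yes s = β , λ (u , adj , eq) →
        proj₁ (barβ u λ su → bipartite v u adj (trans s (sym su))) eq
      ... | no ¬s = α , λ (u , adj , eq) →
        proj₁ (barα u (trans (≢⇒≡opposite ≤-refl (≢-sym (bipartite v u adj)))
                             (sym (≢⇒≡opposite ≤-refl (≢-sym ¬s))))) eq

-- The crown in coordinates

module Crown {N n : ℕ} (coordinates : Fin n ↔ (Fin N × Fin 2)) where
  open Inverse coordinates using (to; from; strictlyInverseˡ; strictlyInverseʳ)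

  index : Fin n → Fin N
  index = proj₁ ∘ to

  side : Fin n → Fin 2
  side = proj₂ ∘ to

  index-from : ∀ i s → index (from (i , s)) ≡ i
  index-from i s = cong proj₁ (strictlyInverseˡ (i , s))

  side-from : ∀ i s → side (from (i , s)) ≡ s
  side-from i s = cong proj₂ (strictlyInverseˡ (i , s))

  coordinates-injective : ∀ {u v} → index u ≡ index v → side u ≡ side v → u ≡ v
  coordinates-injective {u} {v} i s = trans (sym (strictlyInverseʳ u))
    (trans (cong₂ (λ i s → from (i , s)) i s) (strictlyInverseʳ v))

  twin : Fin n → Fin n
  twin v = from (index v , opposite (side v))

  index-twin : ∀ v → index (twin v) ≡ index v
  index-twin v = index-from (index v) _

  side-twin : ∀ v → side (twin v) ≡ opposite (side v)
  side-twin v = side-from (index v) _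

  twin-≢ : ∀ v → twin v ≢ v
  twin-≢ v eq = opposite-≢ (side v) (trans (sym (side-twin v)) (cong side eq))

  index-≡⇒twin : ∀ {u v} → index u ≡ index v → u ≢ v → u ≡ twin v
  index-≡⇒twin {u} {v} i u≢v = coordinates-injective (trans i (sym (index-twin v)))
    (trans (≢⇒≡opposite ≤-refl (u≢v ∘ coordinates-injective i)) (sym (side-twin v)))

  crown : Graph n
  crown = record
    { Adj         = λ u v → index u ≢ index v × side u ≢ side v
    ; adj?        = λ u v → ¬? (index u Fin.≟ index v) ×-dec ¬? (side u Fin.≟ side v)
    ; symmetric   = λ (i , s) → ≢-sym i , ≢-sym s
    ; irreflexive = λ { refl (i , _) → i refl }
    }

  -- Lower bound for the crown: Bob's twin strategy

  module _ {k : ℕ} (k<N : k < N) where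
    open Game crown k

    -- The invariant that Bob restores with each reply; its first half also makes twins uncoloured
    -- together.
    Twinned : Colouring k n → Set
    Twinned c =
      (∀ {u v} → index u ≡ index v → lookup c u ≡ lookup c v) ×
      (∀ {u v a} → lookup c u ≡ just a → lookup c v ≡ just a → index u ≡ index v)

    module _ (c : Colouring k n) (twinned : Twinned c) where
      open Σ twinned renaming (proj₁ to same; proj₂ to distinct)

      -- The `N` pairs would need distinct colours, but `k < N`.
      twinned⇒¬complete : ¬ (∀ v → ¬ Uncoloured c v)
      twinned⇒¬complete full =
        let i , j , i<j , eq = pigeonhole k<N (proj₁ ∘ colour)
        in Fin.<⇒≢ i<j (trans (sym (index-from i zero)) (trans
             (distinct (proj₂ (colour i)) (trans (proj₂ (colour j)) (cong just (sym eq))))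
             (index-from j zero)))
        where
        colour : ∀ i → ∃[ a ] lookup c (from (i , zero)) ≡ just a
        colour i with lookup c (from (i , zero)) in eq
        ... | just a  = a , refl
        ... | nothing = contradiction eq (full (from (i , zero)))

      module _ (v : Fin n) (a : Fin k) (legal : Legal c v a) where
        open Σ legal renaming (proj₁ to vᵤ; proj₂ to ¬app)

        -- If a vertex of another pair on the side of `v` had colour `a`, so would its twin, which
        -- is a neighbour of `v`.
        legal⇒unused : ∀ u → lookup c u ≢ just a
        legal⇒unused u eq with index u Fin.≟ index v | side u Fin.≟ side v
        ... | yes i | _     = case trans (sym vᵤ) (trans (sym (same i)) eq) of λ ()
        ... | no ¬i | no ¬s = ¬app (u , (≢-sym ¬i , ≢-sym ¬s) , eq)
        ... | no ¬i | yes s = ¬app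
          ( twin u
          , ( (λ i → ¬i (trans (sym (index-twin u)) (sym i)))
            , λ s′ → opposite-≢ (side u) (trans (sym (side-twin u)) (trans (sym s′) (sym s))))
          , trans (same (index-twin u)) eq )

        twin-uncoloured : Uncoloured (c [ v ]≔ just a) (twin v)
        twin-uncoloured = trans (lookup∘update′ (twin-≢ v) c _) (trans (same (index-twin v)) vᵤ)

        twin-legal : Legal (c [ v ]≔ just a) (twin v) a
        twin-legal = twin-uncoloured , λ (u , (i , _) , eq) → case coloured⁻ c v eq of λ
          { (inj₁ (refl , _)) → i (index-twin v)
          ; (inj₂ old)        → legal⇒unused u old }

        private
          c′ : Colouring k n
          c′ = (c [ v ]≔ just a) [ twin v ]≔ just a

          inside : ∀ {u} → index u ≡ index v → lookup c′ u ≡ just a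
          inside {u} i with u Fin.≟ v
          ... | yes refl = coloured⁺ (c [ v ]≔ just a) (twin v) twin-uncoloured
                             (lookup∘update v c _)
          ... | no u≢v   = trans (cong (lookup c′) (index-≡⇒twin i u≢v))
                             (lookup∘update (twin v) (c [ v ]≔ just a) _)

          outside : ∀ {u} → index u ≢ index v → lookup c′ u ≡ lookup c u
          outside ¬i = trans
            (lookup∘update′ (λ { refl → ¬i (index-twin v) }) (c [ v ]≔ just a) _)
            (lookup∘update′ (λ { refl → ¬i refl }) c _)

        twinned-move : Twinned c′
        twinned-move = same′ , distinct′
          where
          same′ : ∀ {u w} → index u ≡ index w → lookup c′ u ≡ lookup c′ w
          same′ {u} {w} i with index w Fin.≟ index v
          ... | yes j = trans (inside (trans i j)) (sym (inside j))
          ... | no ¬j = trans (outside (¬j ∘ trans (sym i))) (trans (same i) (sym (outside ¬j)))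

          distinct′ : ∀ {u w b} → lookup c′ u ≡ just b → lookup c′ w ≡ just b →
                      index u ≡ index w
          distinct′ {u} {w} p q with index u Fin.≟ index v | index w Fin.≟ index v
          ... | yes i | yes j = trans i (sym j)
          ... | yes i | no ¬j = contradiction
            (trans (sym (outside ¬j)) (trans q (trans (sym p) (inside i)))) (legal⇒unused w)
          ... | no ¬i | yes j = contradiction
            (trans (sym (outside ¬i)) (trans p (trans (sym q) (inside j)))) (legal⇒unused u)
          ... | no ¬i | no ¬j =
            distinct (trans (sym (outside ¬i)) p) (trans (sym (outside ¬j)) q)

    -- Recursion on Alice's strategy tree: Bob answers `v` with `twin v` in the same colour. The
    -- game cannot end between the two moves, as `twin v` is then still uncoloured.
    twinned⇒¬aliceWins : ∀ c → Twinned c → ¬ AliceWins alice c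
    twinned⇒¬aliceWins c inv (complete full) = twinned⇒¬complete c inv full
    twinned⇒¬aliceWins c inv (alice-to-move _ v a l (complete full)) =
      full (twin v) (twin-uncoloured c inv v a l)
    twinned⇒¬aliceWins c inv (alice-to-move _ v a l (bob-to-move _ reply)) =
      twinned⇒¬aliceWins _ (twinned-move c inv v a l)
        (reply (twin v) a (twin-legal c inv v a l))

    crown-lower : ¬ AliceHasWinningStrategy crown k
    crown-lower = twinned⇒¬aliceWins _
      ( (λ {u} {v} _ → trans (lookup-replicate u nothing) (sym (lookup-replicate v nothing)))
      , λ {u} eq → case trans (sym (lookup-replicate u nothing)) eq of λ () )

-- Upper bound for the crown

module _ {N n : ℕ} (coordinates : Fin n ↔ (Fin (suc N) × Fin 2)) where
  open Inverse coordinates using (from)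
  open Crown coordinates
  open Game crown (suc N)
  open Strategies crown (suc N)

  private
    neighbour : Fin n → Fin N → Fin n
    neighbour v j = from (punchIn (index v) j , opposite (side v))

    neighbour-onto : ∀ {u v} (i : index v ≢ index u) → side v ≢ side u →
                     neighbour v (punchOut i) ≡ u
    neighbour-onto i s = coordinates-injective
      (trans (index-from _ _) (punchIn-punchOut i))
      (trans (side-from _ _) (sym (≢⇒≡opposite ≤-refl (≢-sym s))))

    -- All neighbours of `v` are among the `N` values of `neighbour v`, so one of the `suc N`
    -- colours is missing. This holds in every position, whence the trivial invariant.
    free : ∀ c v → ⊤ → Uncoloured c v → ∃[ a ] ¬ Appears c v a
    free c v _ _ with a , new ← fresh (n<1+n N) (lookup c ∘ neighbour v) =
      a , λ (u , (i , s) , eq) →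
        new (punchOut i) (trans (cong (lookup c) (neighbour-onto i s)) eq)

  crown-upper : AliceHasWinningStrategy crown (suc N)
  crown-upper = aliceWins-invariant (λ _ → ⊤) free (λ _ _ _ _ _ → tt) alice _ tt

  χg-crown : χg crown ≡ suc N
  χg-crown = χg-unique crown (crown-upper , λ j w → ≮⇒≥ λ j<N → crown-lower j<N w)

-- The crown minus a vertex

module _ {N m : ℕ} (coordinates : Fin (suc m) ↔ (Fin N × Fin 2)) (x : Fin (suc m)) where
  open Inverse coordinates using (from)
  open Crown coordinates
  open Graph (crown - x)

  private
    indexˣ : Fin m → Fin N
    indexˣ = index ∘ punchIn x

    sideˣ : Fin m → Fin 2
    sideˣ = side ∘ punchIn x

    vertex : ∀ i s → (i ≢ index x) ⊎ (s ≢ side x) → ∃[ u ] (indexˣ u ≡ i × sideˣ u ≡ s)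
    vertex i s ne =
      punchOut x≢ ,
      trans (cong index (punchIn-punchOut x≢)) (index-from i s) ,
      trans (cong side (punchIn-punchOut x≢)) (side-from i s)
      where
      x≢ : x ≢ from (i , s)
      x≢ eq = case ne of λ
        { (inj₁ ¬i) → ¬i (trans (sym (index-from i s)) (sym (cong index eq)))
        ; (inj₂ ¬s) → ¬s (trans (sym (side-from i s)) (sym (cong side eq))) }

    coordinatesˣ-injective : ∀ {u v} → indexˣ u ≡ indexˣ v → sideˣ u ≡ sideˣ v → u ≡ v
    coordinatesˣ-injective i s = punchIn-injective x _ _ (coordinates-injective i s)

    ∅ : ∀ {k} → Colouring k m
    ∅ = replicate _ nothing

    ∅-uncoloured : ∀ {k} u → lookup (∅ {k}) u ≡ nothing
    ∅-uncoloured u = lookup-replicate u nothing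

    ∅-coloured : ∀ {k} u {a : Fin k} → lookup ∅ u ≢ just a
    ∅-coloured u eq = case trans (sym (∅-uncoloured u)) eq of λ ()

    -- Supplies Bob's trap against a first move at `v`. The index of `u` must avoid three values,
    -- including that of `x` so that `u` surely exists; hence `4 ≤ N`.
    triple : 4 ≤ N → ∀ v → ∃[ w ] ∃[ u ]
             (w ≢ v × sideˣ w ≡ sideˣ v × Adj u v × Adj u w)
    triple 4≤N v =
      -- The repeated entry pads the list to length three, to match `4≤N`.
      let i , new-i       = avoid 4≤N (index x ∷ indexˣ v ∷ indexˣ v ∷ [])
          w , iw , sw     = vertex i (sideˣ v) (inj₁ (≢-sym (new-i zero)))
          j , new-j       = avoid 4≤N (index x ∷ indexˣ v ∷ i ∷ [])
          u , iu , su     = vertex j (opposite (sideˣ v)) (inj₁ (≢-sym (new-j zero)))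
          su≢sv           = opposite-≢ (sideˣ v) ∘ trans (sym su)
      in w , u , (λ w≡v → new-i (suc zero) (trans (sym (cong indexˣ w≡v)) iw)) , sw ,
         ((λ iu≡iv → new-j (suc zero) (trans (sym iu≡iv) iu)) , su≢sv) ,
         ((λ iu≡iw → new-j (suc (suc zero)) (trans (sym iw) (trans (sym iu≡iw) iu))) ,
          λ su≡sw → su≢sv (trans su≡sw sw))

    adjacent⇒≢ : ∀ {u v} → Adj u v → u ≢ v
    adjacent⇒≢ (i , _) refl = i refl

    update-∅ : ∀ {k} {u v} {a : Fin k} → u ≢ v → lookup (∅ [ v ]≔ just a) u ≡ nothing
    update-∅ {u = u} u≢v = trans (lookup∘update′ u≢v ∅ _) (∅-uncoloured u)

  -- Fewer than three colours do not suffice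

  module _ {k : ℕ} (4≤N : 4 ≤ N) (k<3 : k < 3) where
    open Game (crown - x) k
    open Strategies (crown - x) k

    private
      -- Bob gives `w` the colour `opposite a`, which is legal because the only coloured vertex `v`
      -- is on the same side. As `k < 3`, there are no colours besides `a` and `opposite a`, and `u`
      -- sees both.
      first-move-loses : ∀ v a w u → w ≢ v → sideˣ w ≡ sideˣ v → Adj u v → Adj u w →
                         ¬ AliceWins bob (∅ [ v ]≔ just a)
      first-move-loses v a w u w≢v sw uv uw (complete full)       = full w (update-∅ w≢v)
      first-move-loses v a w u w≢v sw uv uw (bob-to-move _ reply) =
        bobHasWon⇒¬aliceWins alice c₂ (u , u-uncoloured , appears) (reply w (opposite a) w-legal)
        where
        c₁ c₂ : Colouring k m
        c₁ = ∅ [ v ]≔ just a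
        c₂ = c₁ [ w ]≔ just (opposite a)

        w-legal : Legal c₁ w (opposite a)
        w-legal = update-∅ w≢v , λ (z , (_ , wz) , eq) → case coloured⁻ ∅ v eq of λ
          { (inj₁ (refl , _)) → wz sw
          ; (inj₂ old)        → ∅-coloured z old }

        u-uncoloured : Uncoloured c₂ u
        u-uncoloured = trans (lookup∘update′ (adjacent⇒≢ uw) c₁ _) (update-∅ (adjacent⇒≢ uv))

        appears : ∀ b → Appears c₂ u b
        appears b with b Fin.≟ a
        ... | yes refl = v , uv , trans (lookup∘update′ (≢-sym w≢v) c₁ _) (lookup∘update v ∅ _)
        ... | no b≢a   = w , uw , trans (lookup∘update w c₁ _)
                                        (cong just (sym (≢⇒≡opposite k<3 b≢a)))

    crown-minus-lower : ¬ AliceHasWinningStrategy (crown - x) k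
    crown-minus-lower (complete full) =
      let i , new = avoid 4≤N (index x ∷ index x ∷ index x ∷ [])
          u , _   = vertex i zero (inj₁ (≢-sym (new zero)))
      in full u (∅-uncoloured u)
    crown-minus-lower (alice-to-move _ v a _ win) =
      let w , u , w≢v , sw , uv , uw = triple 4≤N v
      in first-move-loses v a w u w≢v sw uv uw win

  -- Alice's strategy with three colours

  module _ where
    open Game (crown - x) 3
    open Strategies (crown - x) 3

    private
      -- Here `p` and `q` are twins. An uncoloured vertex opposite `p` is not `q`, so it is adjacent
      -- to `p` and sees `β`; thus `β` is barred from the whole side of `q`.
      settled⇒aliceWins : ∀ c β p q → indexˣ p ≡ indexˣ q → sideˣ p ≡ side x → sideˣ q ≢ side x →
        (∀ v → sideˣ v ≡ side x → Barred c v zero) →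
        lookup c p ≡ just β → ¬ Uncoloured c q →
        (∀ u → sideˣ u ≢ side x → lookup c u ≢ just β) →
        AliceWins bob c
      settled⇒aliceWins c β p q i sp sq bar₀ pβ q-coloured ¬β =
        barred-sides⇒aliceWins sideˣ (λ _ _ → proj₂) (side x) zero β bob c bar₀ λ u su →
          ¬β u su , λ uᵤ → p ,
            ( (λ iu → q-coloured (subst (Uncoloured c)
                (coordinatesˣ-injective (trans iu i)
                  (trans (≢⇒≡opposite ≤-refl su) (sym (≢⇒≡opposite ≤-refl sq)))) uᵤ))
            , λ su′ → su (trans su′ sp)) ,
            pβ

      -- The twin of x, which Alice colours first; the colour α is zero.
      y : Fin m
      y = proj₁ (vertex (index x) (opposite (side x)) (inj₂ (opposite-≢ (side x))))

      index-y : indexˣ y ≡ index x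
      index-y = proj₁ (proj₂ (vertex (index x) (opposite (side x)) (inj₂ (opposite-≢ (side x)))))

      side-y : sideˣ y ≡ opposite (side x)
      side-y = proj₂ (proj₂ (vertex (index x) (opposite (side x)) (inj₂ (opposite-≢ (side x)))))

      side-y≢ : sideˣ y ≢ side x
      side-y≢ = opposite-≢ (side x) ∘ trans (sym side-y)

      -- On its side, only the deleted `x` was not adjacent to `y`.
      adjacent-y : ∀ {v} → sideˣ v ≡ side x → Adj v y
      adjacent-y {v} s =
        (λ i → punchInᵢ≢i x v (coordinates-injective (trans i index-y) s)) ,
        (λ s′ → side-y≢ (trans (sym s′) s))

      c₁ : Colouring 3 m
      c₁ = ∅ [ y ]≔ just zero

      coloured₁ : ∀ {u b} → lookup c₁ u ≡ just b → u ≡ y × zero ≡ b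
      coloured₁ {u} eq = case coloured⁻ ∅ y eq of λ
        { (inj₁ p)   → p
        ; (inj₂ old) → contradiction old (∅-coloured u) }

      barred₁ : ∀ v → sideˣ v ≡ side x → Barred c₁ v zero
      barred₁ v s =
        (λ eq → side-y≢ (subst (λ u → sideˣ u ≡ side x) (proj₁ (coloured₁ eq)) s)) ,
        λ _ → y , adjacent-y s , lookup∘update y ∅ _

      module _ (v : Fin m) (a : Fin 3) (l : Legal c₁ v a) where

        c₂ : Colouring 3 m
        c₂ = c₁ [ v ]≔ just a

        coloured₂ : ∀ {u b} → lookup c₂ u ≡ just b → (u ≡ v × a ≡ b) ⊎ (u ≡ y × zero ≡ b)
        coloured₂ eq = case coloured⁻ c₁ v eq of λ
          { (inj₁ p)   → inj₁ p
          ; (inj₂ old) → inj₂ (coloured₁ old) }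

        uncoloured₂ : ∀ {u} → u ≢ v → u ≢ y → Uncoloured c₂ u
        uncoloured₂ u≢v u≢y = trans (lookup∘update′ u≢v c₁ _) (update-∅ u≢y)

        barred₂ : ∀ u → sideˣ u ≡ side x → Barred c₂ u zero
        barred₂ u s = barred-move c₁ v a u zero l (barred₁ u s)

        ¬bobHasWon₂ : ¬ BobHasWon c₂
        ¬bobHasWon₂ with b , new ← avoid (s≤s (s≤s (s≤s z≤n))) (zero ∷ a ∷ []) =
          unused⇒¬bobHasWon c₂ b λ u eq → case coloured₂ eq of λ
            { (inj₁ (_ , a≡b)) → new (suc zero) a≡b
            ; (inj₂ (_ , 0≡b)) → new zero 0≡b }

        -- Of the two vertices with this index, `x` is deleted and `y` already coloured. Hence the
        -- twin of `v` is still present.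
        index-v≢ : indexˣ v ≢ index x
        index-v≢ i with sideˣ v Fin.≟ side x
        ... | yes s = proj₁ (adjacent-y s) (trans i (sym index-y))
        ... | no ¬s = case trans (sym (proj₁ l)) (trans
          (cong (lookup c₁) (coordinatesˣ-injective (trans i (sym index-y))
            (trans (≢⇒≡opposite ≤-refl ¬s) (sym side-y))))
          (lookup∘update y ∅ _)) of λ ()

        -- Bob's colour `a` is not zero, as `y` bars zero from this side. Alice gives the twin `q`
        -- the colour zero, which `y` on the same side already has, so `a` is absent from that side
        -- and can act as `β`.
        replyˢ : sideˣ v ≡ side x → AliceWins alice c₂
        replyˢ s with q , iq , sq ← vertex (indexˣ v) (opposite (side x)) (inj₁ index-v≢) =
          alice-to-move ¬bobHasWon₂ q zero (q-uncoloured , ¬0)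
            (settled⇒aliceWins c₃ a v q (sym iq) s sq≢
              (λ u su → barred-move c₂ q zero u zero (q-uncoloured , ¬0) (barred₂ u su))
              (coloured⁺ c₂ q q-uncoloured (lookup∘update v c₁ _))
              (λ qᵤ → case trans (sym (lookup∘update q c₂ _)) qᵤ of λ ())
              (λ u su eq → case coloured⁻ c₂ q eq of λ
                { (inj₁ (_ , 0≡a)) → a≢0 (sym 0≡a)
                ; (inj₂ old)       → case coloured₂ old of λ
                  { (inj₁ (refl , _)) → su s
                  ; (inj₂ (_ , 0≡a))  → a≢0 (sym 0≡a) } }))
          where
          c₃ : Colouring 3 m
          c₃ = c₂ [ q ]≔ just zero

          a≢0 : a ≢ zero
          a≢0 refl = proj₂ l (y , adjacent-y s , lookup∘update y ∅ _)

          sq≢ : sideˣ q ≢ side x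
          sq≢ = opposite-≢ (side x) ∘ trans (sym sq)

          q-uncoloured : Uncoloured c₂ q
          q-uncoloured = uncoloured₂ (λ q≡v → sq≢ (trans (cong sideˣ q≡v) s))
            (λ q≡y → index-v≢ (trans (sym iq) (trans (cong indexˣ q≡y) index-y)))

          ¬0 : ¬ Appears c₂ q zero
          ¬0 (u , (iu , su) , eq) = case coloured₂ eq of λ
            { (inj₁ (refl , _)) → iu iq
            ; (inj₂ (refl , _)) → su (trans sq (sym side-y)) }

        -- Alice colours the twin `p` with a colour `β` other than zero and `a`. It is new to the
        -- whole graph, hence legal at `p` and absent from the side of `v`.
        replyᵒ : sideˣ v ≢ side x → AliceWins alice c₂
        replyᵒ ¬s
          with p , ip , sp ← vertex (indexˣ v) (side x) (inj₁ index-v≢)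
             | β , new ← avoid (s≤s (s≤s (s≤s z≤n))) (zero ∷ a ∷ []) =
          alice-to-move ¬bobHasWon₂ p β (p-uncoloured , λ (u , _ , eq) → ¬β u eq)
            (settled⇒aliceWins c₃ β p v ip sp ¬s
              (λ u su → barred-move c₂ p β u zero
                (p-uncoloured , λ (u , _ , eq) → ¬β u eq) (barred₂ u su))
              (lookup∘update p c₂ _)
              (λ vᵤ → case trans (sym (coloured⁺ c₂ p p-uncoloured (lookup∘update v c₁ _))) vᵤ
                of λ ())
              (λ u su eq → case coloured⁻ c₂ p eq of λ
                { (inj₁ (refl , _)) → su sp
                ; (inj₂ old)        → ¬β u old }))
          where
          c₃ : Colouring 3 m
          c₃ = c₂ [ p ]≔ just β

          p-uncoloured : Uncoloured c₂ p
          p-uncoloured = uncoloured₂ (λ p≡v → ¬s (trans (sym (cong sideˣ p≡v)) sp))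
            (λ p≡y → side-y≢ (trans (sym (cong sideˣ p≡y)) sp))

          ¬β : ∀ u → lookup c₂ u ≢ just β
          ¬β u eq = case coloured₂ eq of λ
            { (inj₁ (_ , a≡β)) → new (suc zero) a≡β
            ; (inj₂ (_ , 0≡β)) → new zero 0≡β }

        reply : AliceWins alice c₂
        reply with sideˣ v Fin.≟ side x
        ... | yes s = replyˢ s
        ... | no ¬s = replyᵒ ¬s

    crown-minus-upper : AliceHasWinningStrategy (crown - x) 3
    crown-minus-upper =
      alice-to-move (unused⇒¬bobHasWon ∅ zero λ u → ∅-coloured u) y zero
        (∅-uncoloured y , λ (u , _ , eq) → ∅-coloured u eq)
        (bob-to-move
          (unused⇒¬bobHasWon c₁ (suc zero) λ u eq → case proj₂ (coloured₁ {u} eq) of λ ())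
          reply)

  χg-crown-minus : 4 ≤ N → χg (crown - x) ≡ 3
  χg-crown-minus 4≤N = χg-unique (crown - x)
    (crown-minus-upper , λ k w → ≮⇒≥ λ k<3 → crown-minus-lower 4≤N k<3 w)

-- Criticality and the choice of the crown

constant-difference⇒critical : ∀ {m k l} (G : Graph (suc m)) → k < l →
  χg G ≡ l → (∀ x → χg (G - x) ≡ k) →
  LowerGameVertexCritical G × (∀ x → χg G ∸ χg (G - x) ≡ l ∸ k)
constant-difference⇒critical G k<l eq eq- =
  (λ x → subst₂ _<_ (sym (eq- x)) (sym eq) k<l) , λ x → cong₂ _∸_ eq (eq- x)

-- Stated for arbitrary m and N, because the type checker would evaluate χg on
-- a concrete crown when it compares types.
crown-critical : ∀ {m N} → 4 ≤ suc N → Fin (suc m) ↔ (Fin (suc N) × Fin 2) →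
  Σ[ G ∈ Graph (suc m) ] (LowerGameVertexCritical G × (∀ x → χg G ∸ χg (G - x) ≡ suc N ∸ 3))
crown-critical 4≤N coordinates = crown ,
  constant-difference⇒critical crown 4≤N (χg-crown coordinates)
    (λ x → χg-crown-minus coordinates x 4≤N)
  where open Crown coordinates

proposition6 : ∀ (n : ℕ) → n ≥ 1 →
    ∃[ m ] Σ[ G ∈ Graph (suc m) ]
    (LowerGameVertexCritical G × (∀ x → χg G ∸ χg (G - x) ≡ n))
-- The crown has `(3 + n) * 2` vertices, two of them split off as successors. With `3 + n` pairs,
-- the difference `suc N ∸ 3` computes to `n`, and `n ≥ 1` yields `4 ≤ suc N`.
proposition6 n n≥1 = suc ((2 + n) * 2) ,
  crown-critical {suc ((2 + n) * 2)} {2 + n} (+-monoʳ-≤ 3 n≥1) Fin.*↔×
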